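{- The CCQ entailment problem over unrestricted quad-systems is undecidable. That is, the following decision problem is undecidable: given a quad-system $QS_{\mathcal{C}}=\langle Q_{\mathcal{C}},R\rangle$, where $R$ is an arbitrary set of bridge rules of the general forall-existential form, a contextualized conjunctive query $CQ(\vec x)$ and a vector $\vec a$ of constants with $\|\vec a\|=\|\vec x\|$, decide whether $QS_{\mathcal{C}}\models CQ(\vec a)$.
   Context: Notation. $\|\vec x\|$ is the length of a vector $\vec x$ and $\{\vec x\}$ its set of symbols. Let $\mathbf{U}$ (URIs), $\mathbf{B}$ (blank nodes), $\mathbf{L}$ (literals) be pairwise disjoint sets, $\mathbf{C}=\mathbf{U}\uplus\mathbf{B}\uplus\mathbf{L}$ the set of constants, and $\mathbf{V}$ the set of variables. A triple is any $(s,p,o)\in\mathbf{C}^3$; a graph is a set of triples. A quad is an expression $c\colon(s,p,o)$ with $(s,p,o)$ a triple and $c$ a URI (the context identifier). A quad-graph is a set of quads; $Q_{\mathcal{C}}$ denotes a quad-graph whose set of context identifiers is $\mathcal{C}$, and $graph_{Q_{\mathcal{C}}}(c)=\{(s,p,o)\mid c\colon(s,p,o)\in Q_{\mathcal{C}}\}$. A triple pattern is an element of $(\mathbf{V}\cup\mathbf{C})^3$; a quad pattern is $c\colon t$ with $t$ a triple pattern and $c$ a context identifier. $t(\vec x,\vec y)$ is a triple pattern whose variables are among $\vec x,\vec y$; for a function $\mu$ defined on variables, $t[\mu]$ is the result of replacing each variable by its image (constants are left unchanged). Bridge rules. A bridge rule (BR) is an expression $$\forall \vec x\,\forall \vec z\,[c_1\colon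 t_1(\vec x,\vec z)\wedge\dots\wedge c_n\colon t_n(\vec x,\vec z)\rightarrow\exists\vec y\ c'_1\colon t'_1(\vec x,\vec y)\wedge\dots\wedge c'_m\colon t'_m(\vec x,\vec y)]$$ with $c_1,\dots,c_n,c'_1,\dots,c'_m$ context identifiers, $\{\vec x\},\{\vec y\},\{\vec z\}$ pairwise disjoint sets of variables, and triple patterns containing no blank nodes. A quad-system is a pair $QS_{\mathcal{C}}=\langle Q_{\mathcal{C}},R\rangle$ with $Q_{\mathcal{C}}$ a quad-graph and $R$ a set of BRs (both finite, as inputs). Unrestricted quad-systems are those whose BRs are of the form $\forall \vec x\,\forall \vec z\,[c_1\colon t_1(\vec x,\vec z)\wedge\dots\wedge c_n\colon t_n(\vec x,\vec z)\rightarrow\exists\vec y\ c'_1\colon t'_1(\vec x,\vec y)\wedge\dots\wedge c'_m\colon t'_m(\vec x,\vec y)]$ with no further restriction. Semantics. A local semantics for graphs (such as Simple, RDF, RDFS or OWL-Horst entailment) is fixed, with interpretation structures $I^c=\langle\Delta^c,\cdot^c\rangle$ ($\Delta^c$ the domain, $\cdot^c$ the interpretation function) and satisfaction relation $\models_{\mathrm{local}}$ between local interpretations and graphs; it is assumed that there is a set of inference rules and an operation $\mathsf{lclosure}$ computing the deductive closure of a graph under the local semantics, which on a finite graph terminates in polynomial time with a finite graph of polynomial size. A distributed interpretation is an indexed family $\mathcal{I}^{\mathcal{C}}=\{I^c\}_{c\in\mathcal{C}}$ of local interpretations. It is a model of $QS_{\mathcal{C}}$, written $\mathcal{I}^{\mathcal{C}}\models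 QS_{\mathcal{C}}$, iff: (1) $I^c\models_{\mathrm{local}}graph_{Q_{\mathcal{C}}}(c)$ for each $c\in\mathcal{C}$; (2) $a^{c_i}=a^{c_j}$ for all $a\in\mathbf{C}$ and $c_i,c_j\in\mathcal{C}$; (3) for each BR in $R$ of the form $\forall \vec x\,\forall \vec z\,[c_1\colon t_1(\vec x,\vec z)\wedge\dots\wedge c_n\colon t_n(\vec x,\vec z)\rightarrow\exists\vec y\ c'_1\colon t'_1(\vec x,\vec y)\wedge\dots\wedge c'_m\colon t'_m(\vec x,\vec y)]$ and each $\sigma\colon\mathbf{V}\to\Delta^{\mathcal{C}}=\bigcup_{c\in\mathcal{C}}\Delta^c$, if $I^{c_k}\models_{\mathrm{local}}t_k(\vec x,\vec z)[\sigma]$ for $k=1,\dots,n$, then there is $\sigma'\supseteq\sigma$ (i.e. an assignment that also interprets the existential variables $\vec y$, agreeing with $\sigma$ on $\vec x,\vec z$) with $I^{c'_k}\models_{\mathrm{local}}t'_k(\vec x,\vec y)[\sigma']$ for $k=1,\dots,m$. Queries. A contextualized conjunctive query (CCQ) $CQ(\vec x)$ is an expression $\exists\vec y\ q_1(\vec x,\vec y)\wedge\dots\wedge q_p(\vec x,\vec y)$ with $q_1,\dots,q_p$ quad patterns over free variables $\vec x$ and quantified variables $\vec y$; it is boolean if it has no free variables. For a vector $\vec a$ of constants with $\|\vec a\|=\|\vec x\|$, $\mathcal{I}^{\mathcal{C}}\models CQ(\vec a)$ iff there is an assignment $\mu$ of the variables $\vec y$ to elements of $\Delta^{\mathcal{C}}$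 such that, for each $i$, the quad pattern $q_i(\vec a,\vec y)=c\colon t$ satisfies $I^{c}\models_{\mathrm{local}}t[\mu]$. $QS_{\mathcal{C}}\models CQ(\vec a)$ iff $\mathcal{I}^{\mathcal{C}}\models CQ(\vec a)$ for every model $\mathcal{I}^{\mathcal{C}}$ of $QS_{\mathcal{C}}$.
   Formalization: The claim fails for some local semantics; it is stated for every local semantics given by conditions on simple interpretations with infinitely many unreserved URIs, where each simple interpretation of unreserved names extends without new triples having an unreserved predicate. -}

module Defs where

open import Data.Empty using (⊥)
open import Data.Fin using (Fin; toℕ)
open import Data.Fin.Properties using (toℕ-injective)
open import Data.List using (List; []; _∷_; map)
open import Data.List.Membership.Propositional using (_∈_)
open import Data.List.NonEmpty using (List⁺; _∷_) renaming (map to map⁺)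
import Data.List.NonEmpty.Relation.Unary.All as All⁺
open import Data.List.Relation.Unary.All using (All)
open import Data.Nat using (ℕ; zero; suc; _*_; _≤_; _<_)
open import Data.Nat.Properties using (suc-injective; *-cancelˡ-≡; even≢odd; ≤-refl)
open import Data.Product using (Σ; ∃; ∃₂; ∃-syntax; _×_; _,_; proj₁; proj₂)
open import Data.Sum using (_⊎_; inj₁; inj₂; [_,_]′; map₁; map₂)
open import Data.Unit using (⊤)
open import Data.Vec using (Vec; []; _∷_; lookup)
open import Function using (id; _∘_; _⇔_; mk⇔)
open import Function.Definitions using (Injective)
open import Level using (0ℓ)
open import Relation.Binary.PropositionalEquality using (_≡_; refl; sym; cong; cong₂)
open import Relation.Nullary using (¬_; contradiction)
open import Relation.Unary using (Pred)

-- The three sets of names are countably infinite.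
URI BlankNode Literal : Set
URI       = ℕ
BlankNode = ℕ
Literal   = ℕ

Constant : Set
Constant = URI ⊎ BlankNode ⊎ Literal

pattern uri u     = inj₁ u
pattern blank b   = inj₂ (inj₁ b)
pattern literal l = inj₂ (inj₂ l)

Triple : Set → Set
Triple A = A × A × A

mapTriple : ∀ {A B : Set} → (A → B) → Triple A → Triple B
mapTriple f (s , p , o) = f s , f p , f o

-- The first component is the context identifier.
Quad : Set → Set
Quad A = URI × Triple A

QuadGraph : Set
QuadGraph = List (Quad Constant)

contexts : QuadGraph → List URI
contexts = map proj₁

graph : QuadGraph → URI → Pred (Triple Constant) 0ℓ
graph Q c t = (c , t) ∈ Q

-- A bound vector of n variables is represented by Fin n, so that the
-- vectors x, y and z of a bridge rule are disjoint by construction.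

Term : Set → Set
Term V = V ⊎ Constant

RuleTerm : Set → Set
RuleTerm V = V ⊎ (URI ⊎ Literal)

fromRuleTerm : ∀ {V} → RuleTerm V → Term V
fromRuleTerm = map₂ λ { (inj₁ u) → uri u ; (inj₂ l) → literal l }

-- ∀ x z [ body (x , z) → ∃ y head (x , y) ]
record BridgeRule : Set where
  constructor rule
  field
    {#x #z #y} : ℕ
    body       : List⁺ (Quad (RuleTerm (Fin #x ⊎ Fin #z)))
    head       : List⁺ (Quad (RuleTerm (Fin #x ⊎ Fin #y)))

ContextsIn : ∀ {A : Set} → List URI → List⁺ (Quad A) → Set
ContextsIn C = All⁺.All λ q → proj₁ q ∈ C

-- The set of context identifiers of the quad-graph indexes the local
-- interpretations, so the rules may only mention those.
record QuadSystem : Set where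
  constructor quadSystem
  field
    quads         : QuadGraph
    rules         : List BridgeRule
    .wellFormed   : All (λ r → ContextsIn (contexts quads) (BridgeRule.body r)
                             × ContextsIn (contexts quads) (BridgeRule.head r)) rules

-- ∃ y atoms (x , y), with n free variables x
record CCQ (n : ℕ) : Set where
  constructor ccq
  field
    {#y}  : ℕ
    atoms : List⁺ (Quad (Term (Fin n ⊎ Fin #y)))

substitute : ∀ {n m} → Vec Constant n → Term (Fin n ⊎ Fin m) → Term (Fin m)
substitute a⃗ (inj₁ (inj₁ i)) = inj₂ (lookup a⃗ i)
substitute a⃗ (inj₁ (inj₂ j)) = inj₁ j
substitute a⃗ (inj₂ a)        = inj₂ a

-- All domains of a distributed interpretation are subsets of a common
-- set Ω, so that their union, and the equality of denotations in
-- different contexts, make sense.  Blank nodes are interpreted by the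
-- interpretation function, like the other constants.
record Interpretation (Ω : Set) : Set₁ where
  field
    Δ     : Pred Ω 0ℓ
    ⟦_⟧   : Constant → Ω
    ⟦⟧∈Δ  : ∀ a → Δ ⟦ a ⟧
    Ext   : Ω → Ω → Ω → Set
    Ext⊆Δ : ∀ {s p o} → Ext s p o → Δ s × Δ p × Δ o

-- The triple may contain domain elements in place of variables.
infix 4 _⊨_ _⊨ᵍ_
_⊨_ : ∀ {Ω} → Interpretation Ω → Triple (Ω ⊎ Constant) → Set
I ⊨ (s , p , o) = Ext (value s) (value p) (value o)
  where
  open Interpretation I
  value = [ id , ⟦_⟧ ]′

_⊨ᵍ_ : ∀ {Ω} → Interpretation Ω → Pred (Triple Constant) 0ℓ → Set
I ⊨ᵍ G = ∀ t → G t → I ⊨ mapTriple inj₂ t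

_[_] : ∀ {V A : Set} → Triple (Term V) → (V → A) → Triple (A ⊎ Constant)
t [ μ ] = mapTriple (map₁ μ) t

Unreserved : Pred URI 0ℓ → Pred Constant 0ℓ
Unreserved Reserved (uri u)     = ¬ Reserved u
Unreserved Reserved (blank b)   = ⊤
Unreserved Reserved (literal l) = ⊥

-- I is obtained from J by reinterpreting the reserved vocabulary and the
-- literals, possibly over a larger domain, without any new triple whose
-- predicate is an unreserved URI.
record ConservativeExtension (Reserved : Pred URI 0ℓ) {X Ω : Set}
         (J : Interpretation X) (I : Interpretation Ω) : Set where
  private
    module J = Interpretation J
    module I = Interpretation I
  field
    embed           : X → Ω
    embed-injective : Injective _≡_ _≡_ embed
    embed-Δ         : ∀ {x} → J.Δ x → I.Δ (embed x)
    embed-⟦⟧        : ∀ a → Unreserved Reserved a → I.⟦ a ⟧ ≡ embed J.⟦ a ⟧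
    embed-Ext       : ∀ u → ¬ Reserved u → ∀ a b →
                      I.Ext a I.⟦ uri u ⟧ b ⇔
                      (∃₂ λ s o → a ≡ embed s × b ≡ embed o × J.Ext s J.⟦ uri u ⟧ o)

-- A local semantics is given by semantic conditions on interpretations,
-- which constrain the meaning of a reserved vocabulary (rdf:type,
-- rdfs:subClassOf, owl:sameAs, ...) and of literals only.  The last two
-- fields express this.  Without them the semantic conditions could, for
-- instance, force every triple to hold, which makes every CCQ entailed.
-- Deductive closures are not needed to define entailment.
record LocalSemantics : Set₂ where
  field
    Admissible    : ∀ {Ω} → Interpretation Ω → Set₁
    Reserved      : Pred URI 0ℓ
    unreserved    : ∀ n → ∃[ u ] n ≤ u × ¬ Reserved u
    conservative  : ∀ {X} (J : Interpretation X) →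
                    Σ Set λ Ω → Σ (Interpretation Ω) λ I →
                    Admissible I × ConservativeExtension Reserved J I

simple : LocalSemantics
simple = record
  { Admissible   = λ _ → Level.Lift _ ⊤
  ; Reserved     = λ _ → ⊥
  ; unreserved   = λ n → n , ≤-refl , id
  ; conservative = λ {X} J → X , J , _ , record
      { embed           = id
      ; embed-injective = id
      ; embed-Δ         = id
      ; embed-⟦⟧        = λ _ _ → refl
      ; embed-Ext       = λ _ _ a b →
          mk⇔ (λ e → a , b , refl , refl , e) (λ { (_ , _ , refl , refl , e) → e })
      }
  }

-- Only the members of the family at the contexts of the quad-graph at
-- hand are ever used.
DistributedInterpretation : Set → Set₁
DistributedInterpretation Ω = URI → Interpretation Ω

module _ {Ω : Set} (I : DistributedInterpretation Ω) where

  open Interpretation using (Δ; ⟦_⟧)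

  ⋃Δ : List URI → Pred Ω 0ℓ
  ⋃Δ C w = ∃[ c ] c ∈ C × Δ (I c) w

  Assignment : List URI → Set → Set
  Assignment C V = V → Σ Ω (⋃Δ C)

  SatisfiesAll : ∀ {V C} → Assignment C V → List⁺ (Quad (Term V)) → Set
  SatisfiesAll σ = All⁺.All λ (c , t) → I c ⊨ t [ proj₁ ∘ σ ]

  SatisfiesRule : List URI → BridgeRule → Set
  SatisfiesRule C r =
    (σ : Assignment C (Fin #x ⊎ Fin #z)) →
    SatisfiesAll {C = C} σ (patterns body) →
    ∃[ τ ] SatisfiesAll {C = C} [ σ ∘ inj₁ , τ ]′ (patterns head)
    where
    open BridgeRule r
    patterns : ∀ {V} → List⁺ (Quad (RuleTerm V)) → List⁺ (Quad (Term V))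
    patterns = map⁺ λ (c , t) → c , mapTriple fromRuleTerm t

  SatisfiesQuery : ∀ {n} → List URI → CCQ n → Vec Constant n → Set
  SatisfiesQuery C q a⃗ =
    Σ (Assignment C (Fin #y)) λ μ →
    SatisfiesAll {C = C} μ (map⁺ (λ (c , t) → c , mapTriple (substitute a⃗) t) atoms)
    where
    open CCQ q

  record IsModel (L : LocalSemantics) (QS : QuadSystem) : Set₁ where
    open QuadSystem QS
    private C = contexts quads
    field
      admissible : ∀ {c} → c ∈ C → LocalSemantics.Admissible L (I c)
      graphs     : ∀ {c} → c ∈ C → I c ⊨ᵍ graph quads c
      rigid      : ∀ {c d} → c ∈ C → d ∈ C → ∀ a → ⟦ I c ⟧ a ≡ ⟦ I d ⟧ a
      satisfies  : ∀ {r} → r ∈ rules → SatisfiesRule C r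

Entails : LocalSemantics → QuadSystem → ∀ {n} → CCQ n → Vec Constant n → Set₁
Entails L QS q a⃗ =
  ∀ {Ω} (I : DistributedInterpretation Ω) →
  IsModel I L QS → SatisfiesQuery I (contexts (QuadSystem.quads QS)) q a⃗

record Instance : Set where
  constructor inst
  field
    system      : QuadSystem
    {arity}     : ℕ
    query       : CCQ arity
    answer      : Vec Constant arity
    .wellFormed : ContextsIn (contexts (QuadSystem.quads system)) (CCQ.atoms query)

CCQEntailment : LocalSemantics → Instance → Set₁
CCQEntailment L i = Entails L system query answer
  where open Instance i

data Rec : ℕ → Set where
  zeroᶠ : Rec 0
  sucᶠ  : Rec 1
  proj  : ∀ {n} → Fin n → Rec n
  comp  : ∀ {n m} → Rec m → Vec (Rec n) m → Rec n
  prec  : ∀ {n} → Rec n → Rec (suc (suc n)) → Rec (suc n)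
  min   : ∀ {n} → Rec (suc n) → Rec n

-- f [ xs ]↓ y means that f is defined at xs, with value y.
infix 4 _[_]↓_ _[_]⇊_
mutual
  data _[_]↓_ : ∀ {n} → Rec n → Vec ℕ n → ℕ → Set where
    ↓zero      : zeroᶠ [ [] ]↓ 0
    ↓suc       : ∀ {x} → sucᶠ [ x ∷ [] ]↓ suc x
    ↓proj      : ∀ {n} {i : Fin n} {xs} → proj i [ xs ]↓ lookup xs i
    ↓comp      : ∀ {n m} {f : Rec m} {gs : Vec (Rec n) m} {xs ys z} →
                gs [ xs ]⇊ ys → f [ ys ]↓ z → comp f gs [ xs ]↓ z
    ↓prec-zero : ∀ {n} {f : Rec n} {g xs y} →
                f [ xs ]↓ y → prec f g [ 0 ∷ xs ]↓ y
    ↓prec-suc  : ∀ {n} {f : Rec n} {g k xs y z} →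
                prec f g [ k ∷ xs ]↓ y → g [ k ∷ y ∷ xs ]↓ z →
                prec f g [ suc k ∷ xs ]↓ z
    ↓min       : ∀ {n} {f : Rec (suc n)} {k xs} →
                (∀ {j} → j < k → ∃[ y ] f [ j ∷ xs ]↓ suc y) →
                f [ k ∷ xs ]↓ 0 → min f [ xs ]↓ k

  data _[_]⇊_ {n} : ∀ {m} → Vec (Rec n) m → Vec ℕ n → Vec ℕ m → Set where
    []  : ∀ {xs} → [] [ xs ]⇊ []
    _∷_ : ∀ {m} {g} {gs : Vec (Rec n) m} {xs y ys} →
          g [ xs ]↓ y → gs [ xs ]⇊ ys → (g ∷ gs) [ xs ]⇊ (y ∷ ys)

-- pair a b = 2 ^ a * (2 * b + 1)
pair : ℕ → ℕ → ℕ
pair zero    b = suc (2 * b)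
pair (suc a) b = 2 * pair a b

pair-injective : ∀ a b c d → pair a b ≡ pair c d → a ≡ c × b ≡ d
pair-injective zero b zero d eq = refl , *-cancelˡ-≡ b d 2 (suc-injective eq)
pair-injective zero b (suc c) d eq = contradiction (sym eq) (even≢odd (pair c d) b)
pair-injective (suc a) b zero d eq = contradiction eq (even≢odd (pair a b) d)
pair-injective (suc a) b (suc c) d eq
  with pair-injective a b c d (*-cancelˡ-≡ (pair a b) (pair c d) 2 eq)
... | refl , refl = refl , refl

pair≢0 : ∀ a b → ¬ pair a b ≡ 0
pair≢0 (suc a) b eq = pair≢0 a b (*-cancelˡ-≡ (pair a b) 0 2 eq)

record Coding (A : Set) : Set where
  field
    code           : A → ℕ
    code-injective : Injective _≡_ _≡_ code

open Coding public

ℕᶜ : Coding ℕ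
ℕᶜ = record { code = id ; code-injective = id }

Finᶜ : ∀ {n} → Coding (Fin n)
Finᶜ = record { code = toℕ ; code-injective = toℕ-injective }

Σᶜ : ∀ {A} {B : A → Set} → Coding A → (∀ {a} → Coding (B a)) → Coding (Σ A B)
Σᶜ {A} {B} ca cb = record { code = enc ; code-injective = inj }
  where
  enc : Σ A B → ℕ
  enc (a , b) = pair (code ca a) (code cb b)

  inj : Injective _≡_ _≡_ enc
  inj {a , b} {a′ , b′} eq
    with pair-injective (code ca a) (code cb b) (code ca a′) (code cb b′) eq
  ... | eqa , eqb with code-injective ca eqa
  ... | refl with code-injective cb eqb
  ... | refl = refl

infixr 2 _×ᶜ_
_×ᶜ_ : ∀ {A B} → Coding A → Coding B → Coding (A × B)
ca ×ᶜ cb = Σᶜ ca cb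

infixr 1 _⊎ᶜ_
_⊎ᶜ_ : ∀ {A B} → Coding A → Coding B → Coding (A ⊎ B)
_⊎ᶜ_ {A} {B} ca cb = record { code = enc ; code-injective = λ {x} {y} → inj x y }
  where
  enc : A ⊎ B → ℕ
  enc (inj₁ a) = pair 0 (code ca a)
  enc (inj₂ b) = pair 1 (code cb b)

  inj : ∀ x y → enc x ≡ enc y → x ≡ y
  inj (inj₁ a) (inj₁ a′) eq = cong inj₁ (code-injective ca (proj₂ (pair-injective 0 (code ca a) 0 (code ca a′) eq)))
  inj (inj₂ b) (inj₂ b′) eq = cong inj₂ (code-injective cb (proj₂ (pair-injective 1 (code cb b) 1 (code cb b′) eq)))
  inj (inj₁ a) (inj₂ b)  eq with () ← proj₁ (pair-injective 0 (code ca a) 1 (code cb b) eq)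
  inj (inj₂ b) (inj₁ a)  eq with () ← proj₁ (pair-injective 1 (code cb b) 0 (code ca a) eq)

Listᶜ : ∀ {A} → Coding A → Coding (List A)
Listᶜ {A} ca = record { code = enc ; code-injective = λ {xs} {ys} → inj xs ys }
  where
  enc : List A → ℕ
  enc []       = 0
  enc (x ∷ xs) = pair (code ca x) (enc xs)

  inj : ∀ xs ys → enc xs ≡ enc ys → xs ≡ ys
  inj []       []       eq = refl
  inj []       (y ∷ ys) eq = contradiction (sym eq) (pair≢0 (code ca y) (enc ys))
  inj (x ∷ xs) []       eq = contradiction eq (pair≢0 (code ca x) (enc xs))
  inj (x ∷ xs) (y ∷ ys) eq with pair-injective (code ca x) (enc xs) (code ca y) (enc ys) eq
  ... | eqx , eqxs = cong₂ _∷_ (code-injective ca eqx) (inj xs ys eqxs)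

Vecᶜ : ∀ {A n} → Coding A → Coding (Vec A n)
Vecᶜ {A} ca = record { code = enc ; code-injective = λ {xs} {ys} → inj xs ys }
  where
  enc : ∀ {n} → Vec A n → ℕ
  enc []       = 0
  enc (x ∷ xs) = pair (code ca x) (enc xs)

  inj : ∀ {n} (xs ys : Vec A n) → enc xs ≡ enc ys → xs ≡ ys
  inj []       []       eq = refl
  inj (x ∷ xs) (y ∷ ys) eq with pair-injective (code ca x) (enc xs) (code ca y) (enc ys) eq
  ... | eqx , eqxs = cong₂ _∷_ (code-injective ca eqx) (inj xs ys eqxs)

via : ∀ {A B} {f : A → B} → Injective _≡_ _≡_ f → Coding B → Coding A
via {f = f} f-inj cb = record
  { code           = code cb ∘ f
  ; code-injective = f-inj ∘ code-injective cb
  }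

List⁺ᶜ : ∀ {A} → Coding A → Coding (List⁺ A)
List⁺ᶜ ca = via {f = λ (x ∷ xs) → x , xs} (λ { refl → refl }) (ca ×ᶜ Listᶜ ca)

constantᶜ : Coding Constant
constantᶜ = ℕᶜ ⊎ᶜ ℕᶜ ⊎ᶜ ℕᶜ

quadᶜ : ∀ {A} → Coding A → Coding (Quad A)
quadᶜ ca = ℕᶜ ×ᶜ ca ×ᶜ ca ×ᶜ ca

termᶜ : ∀ {V} → Coding V → Coding (Term V)
termᶜ cv = cv ⊎ᶜ constantᶜ

ruleTermᶜ : ∀ {V} → Coding V → Coding (RuleTerm V)
ruleTermᶜ cv = cv ⊎ᶜ ℕᶜ ⊎ᶜ ℕᶜ

bridgeRuleᶜ : Coding BridgeRule
bridgeRuleᶜ = via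
  {f = λ r → let open BridgeRule r in (#x , #z , #y) , body , head}
  (λ { refl → refl })
  (Σᶜ (ℕᶜ ×ᶜ ℕᶜ ×ᶜ ℕᶜ) (patternsᶜ ×ᶜ patternsᶜ))
  where
  patternsᶜ : ∀ {k l} → Coding (List⁺ (Quad (RuleTerm (Fin k ⊎ Fin l))))
  patternsᶜ = List⁺ᶜ (quadᶜ (ruleTermᶜ (Finᶜ ⊎ᶜ Finᶜ)))

quadSystemᶜ : Coding QuadSystem
quadSystemᶜ = via
  {f = λ QS → let open QuadSystem QS in quads , rules}
  (λ { refl → refl })
  (Listᶜ (quadᶜ constantᶜ) ×ᶜ Listᶜ bridgeRuleᶜ)

ccqᶜ : ∀ {n} → Coding (CCQ n)
ccqᶜ = via
  {f = λ q → let open CCQ q in #y , atoms}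
  (λ { refl → refl })
  (Σᶜ ℕᶜ (List⁺ᶜ (quadᶜ (termᶜ (Finᶜ ⊎ᶜ Finᶜ)))))

instanceᶜ : Coding Instance
instanceᶜ = via
  {f = λ i → let open Instance i in system , arity , query , answer}
  (λ { refl → refl })
  (quadSystemᶜ ×ᶜ Σᶜ ℕᶜ (ccqᶜ ×ᶜ Vecᶜ constantᶜ))

-- d computes the characteristic function of P on codes of instances.
Decides : ∀ {A ℓ} → Coding A → Rec 1 → Pred A ℓ → Set ℓ
Decides cA d P = ∀ a →
  (P a → d [ code cA a ∷ [] ]↓ 1) × (¬ P a → d [ code cA a ∷ [] ]↓ 0)

Undecidable : ∀ {A ℓ} → Coding A → Pred A ℓ → Set ℓ
Undecidable cA P = ¬ (∃[ d ] Decides cA d P)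

{-# OPTIONS --safe #-}

-- Recursive functions are evaluated by a fixed finite set of Horn clauses over binary trees.  A clause becomes
-- a bridge rule by giving a variable to every subterm, and one existential rule provides the trees.  Hence, for
-- a program f and a number n, there is an instance which is entailed iff f maps n to 0: in every model the
-- clauses derive each true evaluation, and conversely the trees, with the true evaluations, form a model, which
-- the local semantics can only extend conservatively.  The number n is given by a chain of n quads, so the
-- code of the instance is a recursive function of n and of the code of the rules.  Given a decision procedure d,
-- let f on input c run d on the code of the instance with input c whose rules have code c.  For c the code of
-- the rules of f itself, that instance is entailed iff d answers no.

module Submission where

open import Data.Empty using (⊥)
open import Data.Fin using (Fin; zero; suc; toℕ; _↑ˡ_; _↑ʳ_; splitAt)
open import Data.Fin.Properties using (splitAt-↑ˡ; splitAt-↑ʳ)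
open import Data.List using (List; []; _∷_; _++_; map; tabulate)
open import Data.List.Membership.Propositional using (_∈_)
open import Data.List.Membership.Propositional.Properties using (∈-map⁺; ∈-map⁻)
open import Data.List.NonEmpty using (List⁺; _∷_) renaming (map to map⁺)
open import Data.List.NonEmpty.Relation.Unary.All using (_∷_) renaming (All to All⁺)
open import Data.List.Relation.Unary.All as All using (All; []; _∷_)
import Data.List.Relation.Unary.All.Properties as Allₚ
open import Data.List.Relation.Unary.Any using (here)
open import Data.Nat using (ℕ; zero; suc; _+_; _*_; _<_; _<′_; z<s; <′-base; ≤′-step)
open import Data.Nat.Properties using (<-trans; <-cmp; <-irrefl; <⇒<′; +-identityʳ; +-suc; m<m+n)
open import Data.Product using (Σ; ∃₂; ∃-syntax; _×_; _,_; proj₁; proj₂)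
open import Data.Sum using (_⊎_; inj₁; inj₂; [_,_]′)
open import Data.Sum.Properties using ([,]-∘)
open import Data.Unit using (⊤; tt)
open import Data.Vec using (Vec; []; _∷_; lookup)
open import Function using (_∘_; id; Equivalence)
open import Function.Definitions using (Injective)
open import Relation.Binary using (tri<; tri≈; tri>)
open import Relation.Binary.PropositionalEquality using (_≡_; refl; sym; trans; cong; cong₂; subst; subst₂)
open import Relation.Nullary using (¬_; contradiction)

open import Defs

private
  variable
    k m n : ℕ

-- Evaluation of recursive functions over binary trees

data Tree : Set where
  leaf : Tree
  node : Tree → Tree → Tree

data Pat (n : ℕ) : Set where
  var  : Fin n → Pat n
  leaf : Pat n
  node : Pat n → Pat n → Pat n

-- These synonyms denote trees as well as patterns.
pattern sucᵗ x = node leaf x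

-- The left child is a numeral from 0 to 7 that tags the kind of program. Two kinds do not occur in
-- `Rec`: `listᵗ` runs a list of programs on the same arguments, and `searchᵗ` tries successive
-- candidates on behalf of `minᵗ`.
pattern zeroᵗ       = node leaf leaf
pattern succᵗ       = node (sucᵗ leaf) leaf
pattern projᵗ i     = node (sucᵗ (sucᵗ leaf)) i
pattern compᵗ f gs  = node (sucᵗ (sucᵗ (sucᵗ leaf))) (node f gs)
pattern listᵗ gs    = node (sucᵗ (sucᵗ (sucᵗ (sucᵗ leaf)))) gs
pattern precᵗ f g   = node (sucᵗ (sucᵗ (sucᵗ (sucᵗ (sucᵗ leaf))))) (node f g)
pattern minᵗ f      = node (sucᵗ (sucᵗ (sucᵗ (sucᵗ (sucᵗ (sucᵗ leaf)))))) f
pattern searchᵗ f   = node (sucᵗ (sucᵗ (sucᵗ (sucᵗ (sucᵗ (sucᵗ (sucᵗ leaf))))))) f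

-- node f v ⇓ y: the program f maps the list v of arguments to y.
infix 4 _⇓_
data _⇓_ : Tree → Tree → Set where
  ⇓zero        : ∀ {v} → node zeroᵗ v ⇓ leaf
  ⇓succ        : ∀ {x v} → node succᵗ (node x v) ⇓ sucᵗ x
  ⇓proj-zero   : ∀ {x v} → node (projᵗ leaf) (node x v) ⇓ x
  ⇓proj-suc    : ∀ {i x v y} → node (projᵗ i) v ⇓ y → node (projᵗ (sucᵗ i)) (node x v) ⇓ y
  ⇓comp        : ∀ {f gs v w y} → node (listᵗ gs) v ⇓ w → node f w ⇓ y → node (compᵗ f gs) v ⇓ y
  ⇓list-[]     : ∀ {v} → node (listᵗ leaf) v ⇓ leaf
  ⇓list-∷      : ∀ {g gs v y w} → node g v ⇓ y → node (listᵗ gs) v ⇓ w →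
                 node (listᵗ (node g gs)) v ⇓ node y w
  ⇓prec-zero   : ∀ {f g v y} → node f v ⇓ y → node (precᵗ f g) (node leaf v) ⇓ y
  ⇓prec-suc    : ∀ {f g i v y z} → node (precᵗ f g) (node i v) ⇓ y → node g (node i (node y v)) ⇓ z →
                 node (precᵗ f g) (node (sucᵗ i) v) ⇓ z
  ⇓min         : ∀ {f v y} → node (searchᵗ f) (node leaf v) ⇓ y → node (minᵗ f) v ⇓ y
  ⇓search-stop : ∀ {f i v} → node f (node i v) ⇓ leaf → node (searchᵗ f) (node i v) ⇓ i
  ⇓search-next : ∀ {f i v y z} → node f (node i v) ⇓ sucᵗ y → node (searchᵗ f) (node (sucᵗ i) v) ⇓ z →
                 node (searchᵗ f) (node i v) ⇓ z

-- This is what makes the answers 1 and 0 of the diagonal program incompatible.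
⇓-deterministic : ∀ {t u u′} → t ⇓ u → t ⇓ u′ → u ≡ u′
⇓-deterministic ⇓zero ⇓zero = refl
⇓-deterministic ⇓succ ⇓succ = refl
⇓-deterministic ⇓proj-zero ⇓proj-zero = refl
⇓-deterministic (⇓proj-suc d) (⇓proj-suc d′) = ⇓-deterministic d d′
⇓-deterministic (⇓comp d e) (⇓comp d′ e′) with refl ← ⇓-deterministic d d′ = ⇓-deterministic e e′
⇓-deterministic ⇓list-[] ⇓list-[] = refl
⇓-deterministic (⇓list-∷ d e) (⇓list-∷ d′ e′) = cong₂ node (⇓-deterministic d d′) (⇓-deterministic e e′)
⇓-deterministic (⇓prec-zero d) (⇓prec-zero d′) = ⇓-deterministic d d′
⇓-deterministic (⇓prec-suc d e) (⇓prec-suc d′ e′) with refl ← ⇓-deterministic d d′ = ⇓-deterministic e e′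
⇓-deterministic (⇓min d) (⇓min d′) = ⇓-deterministic d d′
⇓-deterministic (⇓search-stop _) (⇓search-stop _) = refl
-- Only search has two rules for one input. They exclude each other because `f` would return both
-- zero and a successor.
⇓-deterministic (⇓search-stop d) (⇓search-next d′ _) with () ← ⇓-deterministic d d′
⇓-deterministic (⇓search-next d _) (⇓search-stop d′) with () ← ⇓-deterministic d d′
⇓-deterministic (⇓search-next _ e) (⇓search-next _ e′) = ⇓-deterministic e e′

num : ℕ → Tree
num zero    = leaf
num (suc k) = sucᵗ (num k)

num-injective : num m ≡ num n → m ≡ n
num-injective {zero}  {zero}  _  = refl
num-injective {suc m} {suc n} eq = cong suc (num-injective (child eq))
  where
  child : ∀ {s t} → sucᵗ s ≡ sucᵗ t → s ≡ t
  child refl = refl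

nums : Vec ℕ n → Tree
nums []       = leaf
nums (x ∷ xs) = node (num x) (nums xs)

mutual
  ⌜_⌝ : Rec n → Tree
  ⌜ zeroᶠ ⌝     = zeroᵗ
  ⌜ sucᶠ ⌝      = succᵗ
  ⌜ proj i ⌝    = projᵗ (num (toℕ i))
  ⌜ comp f gs ⌝ = compᵗ ⌜ f ⌝ ⌜ gs ⌝*
  ⌜ prec f g ⌝  = precᵗ ⌜ f ⌝ ⌜ g ⌝
  ⌜ min f ⌝     = minᵗ ⌜ f ⌝

  ⌜_⌝* : Vec (Rec n) m → Tree
  ⌜ [] ⌝*     = leaf
  ⌜ g ∷ gs ⌝* = node ⌜ g ⌝ ⌜ gs ⌝*

⇓proj : (i : Fin n) (xs : Vec ℕ n) → node ⌜ proj i ⌝ (nums xs) ⇓ num (lookup xs i)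
⇓proj zero    (x ∷ xs) = ⇓proj-zero
⇓proj (suc i) (x ∷ xs) = ⇓proj-suc (⇓proj i xs)

-- Induction on the number `m` of candidates between the current one, `i`, and the least zero `k`.
⇓search : ∀ {f v} m {i k} → i + m ≡ k →
          (∀ {j} → j < k → ∃[ y ] node f (node (num j) v) ⇓ num (suc y)) →
          node f (node (num k) v) ⇓ leaf →
          node (searchᵗ f) (node (num i) v) ⇓ num k
⇓search zero    {i} refl below stop rewrite +-identityʳ i = ⇓search-stop stop
⇓search (suc m) {i} refl below stop =
  ⇓search-next (proj₂ (below (m<m+n i z<s))) (⇓search m (sym (+-suc i m)) below stop)

mutual
  -- Determinism of `_⇓_` will take the place of a converse.
  ↓⇒⇓ : ∀ {f : Rec n} {xs y} → f [ xs ]↓ y → node ⌜ f ⌝ (nums xs) ⇓ num y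
  ↓⇒⇓ ↓zero                       = ⇓zero
  ↓⇒⇓ ↓suc                        = ⇓succ
  ↓⇒⇓ (↓proj {i = i} {xs})        = ⇓proj i xs
  ↓⇒⇓ (↓comp ds d)                = ⇓comp (⇊⇒⇓ ds) (↓⇒⇓ d)
  ↓⇒⇓ (↓prec-zero d)              = ⇓prec-zero (↓⇒⇓ d)
  ↓⇒⇓ (↓prec-suc d e)             = ⇓prec-suc (↓⇒⇓ d) (↓⇒⇓ e)
  ↓⇒⇓ (↓min {k = k} below stop)   =
    ⇓min (⇓search k refl (λ j<k → proj₁ (below j<k) , ↓⇒⇓ (proj₂ (below j<k))) (↓⇒⇓ stop))

  ⇊⇒⇓ : ∀ {gs : Vec (Rec n) m} {xs ys} → gs [ xs ]⇊ ys → node (listᵗ ⌜ gs ⌝*) (nums xs) ⇓ nums ys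
  ⇊⇒⇓ []       = ⇓list-[]
  ⇊⇒⇓ (d ∷ ds) = ⇓list-∷ (↓⇒⇓ d) (⇊⇒⇓ ds)

-- Relational rules and the Horn clauses of evaluation

Symbol : Set
Symbol = ℕ

pattern leafˢ  = 0
pattern leftˢ  = 1
pattern rightˢ = 2
pattern domˢ   = 3
pattern evalˢ  = 4
pattern nextˢ  = 5
pattern valˢ   = 6
pattern inputˢ = 7
pattern goalˢ  = 8

-- All relations are binary, as a triple with a fixed predicate is; properties such as `leafˢ`,
-- `domˢ`, `inputˢ` and `goalˢ` are written as loops.
Atom : Set → Set
Atom V = V × Symbol × V

-- The body implicitly contains domˢ (i , i) for every variable i.  In a conservative extension of a structure,
-- these guards confine the variables to that structure.
record GuardedRule : Set where
  field
    {#∀ #∃} : ℕ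
    body    : List (Atom (Fin (suc #∀)))
    head    : List⁺ (Atom (Fin (suc #∀) ⊎ Fin #∃))

-- At least one variable is required, so that the guards alone already give a nonempty rule body.
record Clause : Set where
  constructor _⊢_
  field
    {#vars}    : ℕ
    premises   : List (Atom (Pat (suc #vars)))
    conclusion : Atom (Pat (suc #vars))

Relations : Set → Set₁
Relations A = Symbol → A → A → Set

module _ {A : Set} (R : Relations A) where

  Holds : ∀ {V} → (V → A) → Atom V → Set
  Holds σ (s , P , o) = R P (σ s) (σ o)

  SatisfiesGuarded : GuardedRule → Set
  SatisfiesGuarded r =
    (σ : Fin (suc #∀) → A) → (∀ i → R domˢ (σ i) (σ i)) → All (Holds σ) body →
    ∃[ τ ] All⁺ (Holds [ σ , τ ]′) head
    where open GuardedRule r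

pattern x₀ = var zero
pattern x₁ = var (suc zero)
pattern x₂ = var (suc (suc zero))
pattern x₃ = var (suc (suc (suc zero)))
pattern x₄ = var (suc (suc (suc (suc zero))))
pattern x₅ = var (suc (suc (suc (suc (suc zero)))))

infix 6 _⇓ₚ_
_⇓ₚ_ : Pat n → Pat n → Atom (Pat n)
p ⇓ₚ q = p , evalˢ , q

-- One clause per constructor of `_⇓_`, in the same order. The number in braces is one less than the
-- number of variables.
evalClauses : List Clause
evalClauses =
    _⊢_ {0} [] (node zeroᵗ x₀ ⇓ₚ leaf)
  ∷ _⊢_ {1} [] (node succᵗ (node x₀ x₁) ⇓ₚ sucᵗ x₀)
  ∷ _⊢_ {1} [] (node (projᵗ leaf) (node x₀ x₁) ⇓ₚ x₀)
  ∷ _⊢_ {3} (node (projᵗ x₀) x₂ ⇓ₚ x₃ ∷ []) (node (projᵗ (sucᵗ x₀)) (node x₁ x₂) ⇓ₚ x₃)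
  ∷ _⊢_ {4} (node (listᵗ x₁) x₂ ⇓ₚ x₃ ∷ node x₀ x₃ ⇓ₚ x₄ ∷ []) (node (compᵗ x₀ x₁) x₂ ⇓ₚ x₄)
  ∷ _⊢_ {0} [] (node (listᵗ leaf) x₀ ⇓ₚ leaf)
  ∷ _⊢_ {4} (node x₀ x₂ ⇓ₚ x₃ ∷ node (listᵗ x₁) x₂ ⇓ₚ x₄ ∷ [])
            (node (listᵗ (node x₀ x₁)) x₂ ⇓ₚ node x₃ x₄)
  ∷ _⊢_ {3} (node x₀ x₂ ⇓ₚ x₃ ∷ []) (node (precᵗ x₀ x₁) (node leaf x₂) ⇓ₚ x₃)
  ∷ _⊢_ {5} (node (precᵗ x₀ x₁) (node x₂ x₃) ⇓ₚ x₄ ∷ node x₁ (node x₂ (node x₄ x₃)) ⇓ₚ x₅ ∷ [])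
            (node (precᵗ x₀ x₁) (node (sucᵗ x₂) x₃) ⇓ₚ x₅)
  ∷ _⊢_ {2} (node (searchᵗ x₀) (node leaf x₁) ⇓ₚ x₂ ∷ []) (node (minᵗ x₀) x₁ ⇓ₚ x₂)
  ∷ _⊢_ {2} (node x₀ (node x₁ x₂) ⇓ₚ leaf ∷ []) (node (searchᵗ x₀) (node x₁ x₂) ⇓ₚ x₁)
  ∷ _⊢_ {4} (node x₀ (node x₁ x₂) ⇓ₚ sucᵗ x₃ ∷ node (searchᵗ x₀) (node (sucᵗ x₁) x₂) ⇓ₚ x₄ ∷ [])
            (node (searchᵗ x₀) (node x₁ x₂) ⇓ₚ x₄)
  ∷ []

ground : Tree → Pat n
ground leaf       = leaf
ground (node s t) = node (ground s) (ground t)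

-- valˢ relates the blank node k to the tree of the number k, which no quad can mention because nodeRule
-- produces it.
clauses : Tree → List Clause
clauses f =
    _⊢_ {2} ((x₀ , nextˢ , x₁) ∷ (x₀ , valˢ , x₂) ∷ []) (x₁ , valˢ , sucᵗ x₂)
  ∷ _⊢_ {1} ((x₀ , inputˢ , x₀) ∷ (x₀ , valˢ , x₁) ∷ node (ground f) (node x₁ leaf) ⇓ₚ leaf ∷ [])
            (x₀ , goalˢ , x₀)
  ∷ evalClauses

-- Horn clauses as bridge rules

-- The positions of a pattern at leaves and nodes become additional variables.
size : Pat n → ℕ
size (var _)    = 0
size leaf       = 1
size (node p q) = suc (size p + size q)

sizeᵃ : Atom (Pat n) → ℕ
sizeᵃ (p , _ , q) = size p + size q

sizes : List (Atom (Pat n)) → ℕ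
sizes []       = 0
sizes (a ∷ as) = sizeᵃ a + sizes as

-- Rules have no function symbols. A pattern is therefore represented by the variable at its root
-- together with atoms describing the tree below it. The map `x` places the variables of the
-- pattern, and `y` its positions in preorder.
module Flatten {V : Set} (x : Fin n → V) where

  root : (p : Pat n) → (Fin (size p) → V) → V
  root (var i)    y = x i
  root leaf       y = y zero
  root (node _ _) y = y zero

  shape : (p : Pat n) → (Fin (size p) → V) → List (Atom V)
  shape (var i)    y = []
  shape leaf       y = (y zero , leafˢ , y zero) ∷ []
  shape (node p q) y =
    (y zero , leftˢ , root p y₁) ∷ (y zero , rightˢ , root q y₂) ∷ shape p y₁ ++ shape q y₂
    where
    y₁ = λ i → y (suc (i ↑ˡ size q))
    y₂ = λ i → y (suc (size p ↑ʳ i))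

  rootᵃ : (a : Atom (Pat n)) → (Fin (sizeᵃ a) → V) → Atom V
  rootᵃ (p , P , q) y = root p (λ i → y (i ↑ˡ size q)) , P , root q (λ i → y (size p ↑ʳ i))

  shapeᵃ : (a : Atom (Pat n)) → (Fin (sizeᵃ a) → V) → List (Atom V)
  shapeᵃ (p , _ , q) y = shape p (λ i → y (i ↑ˡ size q)) ++ shape q (λ i → y (size p ↑ʳ i))

  flatten : (as : List (Atom (Pat n))) → (Fin (sizes as) → V) → List (Atom V)
  flatten []       y = []
  flatten (a ∷ as) y = rootᵃ a y₁ ∷ shapeᵃ a y₁ ++ flatten as (λ i → y (sizeᵃ a ↑ʳ i))
    where y₁ = λ i → y (i ↑ˡ sizes as)

open Flatten

module ClauseVariables {k} (ps : List (Atom (Pat (suc k)))) (c : Atom (Pat (suc k))) where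

  #positions : ℕ
  #positions = sizeᵃ c + sizes ps

  ownVar : Fin (suc k) → Fin (suc k + #positions)
  ownVar i = i ↑ˡ #positions

  conclusionVar : Fin (sizeᵃ c) → Fin (suc k + #positions)
  conclusionVar i = suc k ↑ʳ (i ↑ˡ sizes ps)

  premiseVar : Fin (sizes ps) → Fin (suc k + #positions)
  premiseVar i = suc k ↑ʳ (sizeᵃ c ↑ʳ i)

-- The shape of the conclusion belongs to the body: the clause creates no trees but speaks of those
-- that `nodeRule` provides.
clauseRule : Clause → GuardedRule
clauseRule (_⊢_ {k} ps c) = record
  { #∀   = k + #positions
  ; #∃   = 0
  ; body = shapeᵃ ownVar c conclusionVar ++ flatten ownVar ps premiseVar
  ; head = mapAtom inj₁ (rootᵃ ownVar c conclusionVar) ∷ []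
  }
  where
  open ClauseVariables ps c
  mapAtom : ∀ {A B : Set} → (A → B) → Atom A → Atom B
  mapAtom f (s , P , o) = f s , P , f o

-- The only existential rule. The new node is put into the domain again, so that it can be a child
-- of further nodes and all trees arise.
nodeRule : GuardedRule
nodeRule = record
  { #∀   = 1
  ; #∃   = 1
  ; body = []
  ; head = (z , leftˢ , inj₁ zero) ∷ (z , rightˢ , inj₁ (suc zero)) ∷ (z , domˢ , z) ∷ []
  }
  where z = inj₂ zero

guardedRules : Tree → List GuardedRule
guardedRules f = nodeRule ∷ map clauseRule (clauses f)

-- Flattened rules agree with their clauses

module Value {A : Set} (leafᴬ : A) (nodeᴬ : A → A → A) where

  value : (Fin n → A) → Pat n → A
  value θ (var i)    = θ i
  value θ leaf       = leafᴬ
  value θ (node p q) = nodeᴬ (value θ p) (value θ q)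

  fold : Tree → A
  fold leaf       = leafᴬ
  fold (node s t) = nodeᴬ (fold s) (fold t)

  value-ground : (θ : Fin n → A) → ∀ t → value θ (ground t) ≡ fold t
  value-ground θ leaf       = refl
  value-ground θ (node s t) = cong₂ nodeᴬ (value-ground θ s) (value-ground θ t)

  SatisfiesClause : Relations A → Clause → Set
  SatisfiesClause R (ps ⊢ c) = ∀ θ → All (Holds R (value θ)) ps → Holds R (value θ) c

  -- The intended assignment of the position variables: each receives the value of the subpattern at
  -- its position.
  values : (Fin n → A) → (p : Pat n) → Fin (size p) → A
  values θ leaf       _       = leafᴬ
  values θ (node p q) zero    = nodeᴬ (value θ p) (value θ q)
  values θ (node p q) (suc i) = [ values θ p , values θ q ]′ (splitAt (size p) i)

  valuesᵃ : (Fin n → A) → (a : Atom (Pat n)) → Fin (sizeᵃ a) → A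
  valuesᵃ θ (p , _ , q) i = [ values θ p , values θ q ]′ (splitAt (size p) i)

  valuesˡ : (Fin n → A) → (as : List (Atom (Pat n))) → Fin (sizes as) → A
  valuesˡ θ (a ∷ as) i = [ valuesᵃ θ a , valuesˡ θ as ]′ (splitAt (sizeᵃ a) i)

module TreeValue where

  open Value {Tree} leaf node public

  fold-id : ∀ t → fold t ≡ t
  fold-id leaf       = refl
  fold-id (node s t) = cong₂ node (fold-id s) (fold-id t)

module _ {A : Set} {m n : ℕ} {f : Fin m → A} {g : Fin n → A} {σ : Fin (m + n) → A} where
  splitˡ : (∀ i → σ i ≡ [ f , g ]′ (splitAt m i)) → ∀ i → σ (i ↑ˡ n) ≡ f i
  splitˡ h i = trans (h (i ↑ˡ n)) (cong [ f , g ]′ (splitAt-↑ˡ m i n))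

  splitʳ : (∀ i → σ i ≡ [ f , g ]′ (splitAt m i)) → ∀ i → σ (m ↑ʳ i) ≡ g i
  splitʳ h i = trans (h (m ↑ʳ i)) (cong [ f , g ]′ (splitAt-↑ʳ m n i))

module _ {A : Set} (R : Relations A) (leafᴬ : A) (nodeᴬ : A → A → A)
         (dom   : ∀ a → R domˢ a a)
         (leafᵣ : R leafˢ leafᴬ leafᴬ)
         (left  : ∀ a b → R leftˢ (nodeᴬ a b) a)
         (right : ∀ a b → R rightˢ (nodeᴬ a b) b)
  where

  open Value leafᴬ nodeᴬ

  module _ {V : Set} (σ : V → A) (x : Fin n → V) (θ : Fin n → A) (hx : ∀ i → σ (x i) ≡ θ i) where

    root-value : ∀ p y → (∀ i → σ (y i) ≡ values θ p i) → σ (root x p y) ≡ value θ p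
    root-value (var i)    y hy = hx i
    root-value leaf       y hy = hy zero
    root-value (node p q) y hy = hy zero

    shape-holds : ∀ p y → (∀ i → σ (y i) ≡ values θ p i) → All (Holds R σ) (shape x p y)
    shape-holds (var i)    y hy = []
    shape-holds leaf       y hy = subst (λ a → R leafˢ a a) (sym (hy zero)) leafᵣ ∷ []
    shape-holds (node p q) y hy =
        subst₂ (R leftˢ) (sym (hy zero)) (sym (root-value p _ hy₁)) (left _ _)
      ∷ subst₂ (R rightˢ) (sym (hy zero)) (sym (root-value q _ hy₂)) (right _ _)
      ∷ Allₚ.++⁺ (shape-holds p _ hy₁) (shape-holds q _ hy₂)
      where
      hy₁ : ∀ i → σ (y (suc (i ↑ˡ size q))) ≡ values θ p i
      hy₁ = splitˡ (hy ∘ suc)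
      hy₂ : ∀ i → σ (y (suc (size p ↑ʳ i))) ≡ values θ q i
      hy₂ = splitʳ (hy ∘ suc)

    shapeᵃ-holds : ∀ a y → (∀ i → σ (y i) ≡ valuesᵃ θ a i) → All (Holds R σ) (shapeᵃ x a y)
    shapeᵃ-holds (p , _ , q) y hy = Allₚ.++⁺ (shape-holds p _ (splitˡ hy)) (shape-holds q _ (splitʳ hy))

    rootᵃ-value : ∀ a y → (∀ i → σ (y i) ≡ valuesᵃ θ a i) →
                  Holds R σ (rootᵃ x a y) ≡ Holds R (value θ) a
    rootᵃ-value (p , P , q) y hy = cong₂ (R P) (root-value p _ (splitˡ hy)) (root-value q _ (splitʳ hy))

    flatten-holds : ∀ as y → (∀ i → σ (y i) ≡ valuesˡ θ as i) → All (Holds R (value θ)) as →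
                    All (Holds R σ) (flatten x as y)
    flatten-holds []       y hy []       = []
    flatten-holds (a ∷ as) y hy (h ∷ hs) =
        subst id (sym (rootᵃ-value a _ (splitˡ hy))) h
      ∷ Allₚ.++⁺ (shapeᵃ-holds a _ (splitˡ hy)) (flatten-holds as _ (splitʳ hy) hs)

  -- Existence of leaves and nodes is enough: applied to `θ` and the values at all positions, the
  -- rule has its shape atoms satisfied by construction.
  rule⇒clause : ∀ c → SatisfiesGuarded R (clauseRule c) → SatisfiesClause R c
  rule⇒clause (_⊢_ {k} ps c) sat θ hs =
    conclude (sat σ (dom ∘ σ) (Allₚ.++⁺ (shapeᵃ-holds σ ownVar θ own c conclusionVar (splitˡ positions))
                                        (flatten-holds σ ownVar θ own ps premiseVar (splitʳ positions) hs)))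
    where
    open ClauseVariables ps c
    πs : Fin #positions → A
    πs i = [ valuesᵃ θ c , valuesˡ θ ps ]′ (splitAt (sizeᵃ c) i)
    σ : Fin (suc k + #positions) → A
    σ i = [ θ , πs ]′ (splitAt (suc k) i)
    own : ∀ i → σ (ownVar i) ≡ θ i
    own = splitˡ {f = θ} {πs} {σ} (λ _ → refl)
    positions : ∀ i → σ (suc k ↑ʳ i) ≡ πs i
    positions = splitʳ {f = θ} {πs} {σ} (λ _ → refl)
    conclude : ∃[ τ ] All⁺ (Holds R [ σ , τ ]′) (GuardedRule.head (clauseRule (ps ⊢ c))) → Holds R (value θ) c
    conclude (_ , h ∷ []) = subst id (rootᵃ-value σ ownVar θ own c conclusionVar (splitˡ positions)) h

module _ {A : Set} (R : Relations A) (leafᴬ : A) (nodeᴬ : A → A → A)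
         (leaf-unique : ∀ {a} → R leafˢ a a → a ≡ leafᴬ)
         (node-unique : ∀ {a b c} → R leftˢ a b → R rightˢ a c → a ≡ nodeᴬ b c)
  where

  open Value leafᴬ nodeᴬ

  module _ {V : Set} (σ : V → A) (x : Fin n → V) where

    root-unique : ∀ p y → All (Holds R σ) (shape x p y) → σ (root x p y) ≡ value (σ ∘ x) p
    root-unique (var i)    y hs       = refl
    root-unique leaf       y (h ∷ []) = leaf-unique h
    root-unique (node p q) y (l ∷ r ∷ hs) with hs₁ , hs₂ ← Allₚ.++⁻ (shape x p _) hs =
      trans (node-unique l r) (cong₂ nodeᴬ (root-unique p _ hs₁) (root-unique q _ hs₂))

    rootᵃ-unique : ∀ a y → All (Holds R σ) (shapeᵃ x a y) →
                   Holds R σ (rootᵃ x a y) ≡ Holds R (value (σ ∘ x)) a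
    rootᵃ-unique (p , P , q) y hs with hs₁ , hs₂ ← Allₚ.++⁻ (shape x p _) hs =
      cong₂ (R P) (root-unique p _ hs₁) (root-unique q _ hs₂)

    flatten-unique : ∀ as y → All (Holds R σ) (flatten x as y) → All (Holds R (value (σ ∘ x))) as
    flatten-unique []       y []       = []
    flatten-unique (a ∷ as) y (h ∷ hs)
      with hs₁ , hs₂ ← Allₚ.++⁻ (shapeᵃ x a (λ i → y (i ↑ˡ sizes as))) hs =
      subst id (rootᵃ-unique a (λ i → y (i ↑ˡ sizes as)) hs₁) h ∷ flatten-unique as _ hs₂

  -- Here uniqueness of leaves and nodes is used: any position variables that satisfy the shape
  -- atoms must carry the values of their subpatterns.
  clause⇒rule : ∀ c → SatisfiesClause R c → SatisfiesGuarded R (clauseRule c)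
  clause⇒rule (ps ⊢ c) sat σ _ hs = conclude (Allₚ.++⁻ (shapeᵃ ownVar c conclusionVar) hs)
    where
    open ClauseVariables ps c
    conclude : All (Holds R σ) (shapeᵃ ownVar c conclusionVar) × All (Holds R σ) (flatten ownVar ps premiseVar) →
               ∃[ τ ] All⁺ (Holds R [ σ , τ ]′) (GuardedRule.head (clauseRule (ps ⊢ c)))
    conclude (hs₁ , hs₂) = (λ ()) , subst id (sym (rootᵃ-unique σ ownVar c conclusionVar hs₁))
                                      (sat _ (flatten-unique σ ownVar ps premiseVar hs₂)) ∷ []

-- The facts, and the derivation of the goal in every model

-- The blank node k denotes the number k.  Blank nodes are used because they are never reserved.
numeral-steps : ℕ → List (Atom ℕ)
numeral-steps zero    = []
numeral-steps (suc k) = (k , nextˢ , suc k) ∷ (suc k , domˢ , suc k) ∷ numeral-steps k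

facts : ℕ → List (Atom ℕ)
facts n = (0 , leafˢ , 0) ∷ (0 , domˢ , 0) ∷ (0 , valˢ , 0) ∷ (n , inputˢ , n) ∷ numeral-steps n

module _ {A : Set} (R : Relations A) (leafᴬ : A) (nodeᴬ : A → A → A) where

  open Value leafᴬ nodeᴬ

  assign : Vec Tree k → Fin k → A
  assign ts i = fold (lookup ts i)

  -- Induction on the derivation. Each case instantiates the clause of the same name; the vectors
  -- list the trees in the order of the variables of the clause.
  ⇓⇒eval : All (SatisfiesClause R) evalClauses → ∀ {s t} → s ⇓ t → R evalˢ (fold s) (fold t)
  ⇓⇒eval (zero′ ∷ succ ∷ proj-zero ∷ proj-suc ∷ comp′ ∷ list-[] ∷ list-∷ ∷ prec-zero ∷ prec-suc
          ∷ min′ ∷ search-stop ∷ search-next ∷ []) = go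
    where
    go : ∀ {s t} → s ⇓ t → R evalˢ (fold s) (fold t)
    go (⇓zero {v})                         = zero′ (assign (v ∷ [])) []
    go (⇓succ {x} {v})                     = succ (assign (x ∷ v ∷ [])) []
    go (⇓proj-zero {x} {v})                = proj-zero (assign (x ∷ v ∷ [])) []
    go (⇓proj-suc {i} {x} {v} {y} d)       = proj-suc (assign (i ∷ x ∷ v ∷ y ∷ [])) (go d ∷ [])
    go (⇓comp {f} {gs} {v} {w} {y} d e)    = comp′ (assign (f ∷ gs ∷ v ∷ w ∷ y ∷ [])) (go d ∷ go e ∷ [])
    go (⇓list-[] {v})                      = list-[] (assign (v ∷ [])) []
    go (⇓list-∷ {g} {gs} {v} {y} {w} d e)  = list-∷ (assign (g ∷ gs ∷ v ∷ y ∷ w ∷ [])) (go d ∷ go e ∷ [])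
    go (⇓prec-zero {f} {g} {v} {y} d)      = prec-zero (assign (f ∷ g ∷ v ∷ y ∷ [])) (go d ∷ [])
    go (⇓prec-suc {f} {g} {i} {v} {y} {z} d e) =
      prec-suc (assign (f ∷ g ∷ i ∷ v ∷ y ∷ z ∷ [])) (go d ∷ go e ∷ [])
    go (⇓min {f} {v} {y} d)                = min′ (assign (f ∷ v ∷ y ∷ [])) (go d ∷ [])
    go (⇓search-stop {f} {i} {v} d)        = search-stop (assign (f ∷ i ∷ v ∷ [])) (go d ∷ [])
    go (⇓search-next {f} {i} {v} {y} {z} d e) =
      search-next (assign (f ∷ i ∷ v ∷ y ∷ z ∷ [])) (go d ∷ go e ∷ [])

-- The canonical map from trees into a structure picks the witnesses of nodeRule.
module Canonical {Ω : Set} (R : Relations Ω) (f : Tree) (n : ℕ)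
                 (rules-hold : All (SatisfiesGuarded R) (guardedRules f))
                 (⟦_⟧ᵇ : ℕ → Ω) (facts-hold : All (Holds R ⟦_⟧ᵇ) (facts n))
  where

  -- On the elements satisfying the guard, `domˢ` holds everywhere, as `rule⇒clause` demands.
  Dom : Set
  Dom = Σ Ω λ w → R domˢ w w

  R̂ : Relations Dom
  R̂ P a b = R P (proj₁ a) (proj₁ b)

  leaf̂ : Dom
  leaf̂ = ⟦ 0 ⟧ᵇ , All.head (All.tail facts-hold)

  children : Dom → Dom → Fin 2 → Dom
  children a b zero       = a
  children a b (suc zero) = b

  node-exists : ∀ a b → ∃[ c ] R̂ leftˢ c a × R̂ rightˢ c b
  node-exists a b
    with τ , l ∷ r ∷ d ∷ [] ← All.head rules-hold (proj₁ ∘ children a b) (proj₂ ∘ children a b) []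
    = (τ zero , d) , l , r

  nodê : Dom → Dom → Dom
  nodê a b = proj₁ (node-exists a b)

  open Value leaf̂ nodê

  clause-holds : ∀ c → SatisfiesGuarded R (clauseRule c) → SatisfiesClause R̂ c
  clause-holds c sat = rule⇒clause R̂ leaf̂ nodê proj₂ (All.head facts-hold)
    (λ a b → proj₁ (proj₂ (node-exists a b))) (λ a b → proj₂ (proj₂ (node-exists a b))) c restricted
    where
    restricted : SatisfiesGuarded R̂ (clauseRule c)
    restricted σ ds hs with _ , h ∷ [] ← sat (proj₁ ∘ σ) ds hs = (λ ()) , h ∷ []

  clauses-hold : All (SatisfiesClause R̂) (clauses f)
  clauses-hold = All.map (λ {c} → clause-holds c) (Allₚ.map⁻ (All.tail rules-hold))

  -- Induction along the chain of `nextˢ` facts with the first clause. Membership of the blank node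
  -- in the domain is carried along because the clauses range over `Dom`.
  numeral : ∀ k → All (Holds R ⟦_⟧ᵇ) (numeral-steps k) →
            ∃[ d ] R̂ valˢ (⟦ k ⟧ᵇ , d) (fold (num k))
  numeral zero    []             = All.head (All.tail facts-hold) , All.head (All.tail (All.tail facts-hold))
  numeral (suc k) (h ∷ d ∷ hs) with e , v ← numeral k hs =
    d , All.head clauses-hold
          (λ { zero → ⟦ k ⟧ᵇ , e ; (suc zero) → ⟦ suc k ⟧ᵇ , d ; (suc (suc zero)) → fold (num k) })
          (h ∷ v ∷ [])

  goal : node f (node (num n) leaf) ⇓ leaf → R goalˢ ⟦ n ⟧ᵇ ⟦ n ⟧ᵇ
  goal run = conclude facts-hold
    where
    conclude : All (Holds R ⟦_⟧ᵇ) (facts n) → R goalˢ ⟦ n ⟧ᵇ ⟦ n ⟧ᵇ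
    conclude (_ ∷ _ ∷ _ ∷ input ∷ steps) with d , v ← numeral n steps =
      All.head (All.tail clauses-hold) θ (input ∷ v ∷ result ∷ [])
      where
      θ : Fin 2 → Dom
      θ zero       = ⟦ n ⟧ᵇ , d
      θ (suc zero) = fold (num n)
      result : R̂ evalˢ (nodê (value θ (ground f)) (nodê (fold (num n)) leaf̂)) leaf̂
      result = subst (λ t → R̂ evalˢ (nodê t (nodê (fold (num n)) leaf̂)) leaf̂) (sym (value-ground θ f))
                     (⇓⇒eval R̂ leaf̂ nodê (All.tail (All.tail clauses-hold)) run)

-- The intended structure on trees

module Standard (f : Tree) (n : ℕ) where

  -- The relation `goalˢ` ignores its arguments and states that the run returns zero, so any match
  -- of the query yields that run.
  Meaning : Relations Tree
  Meaning leafˢ  s t = s ≡ leaf × t ≡ leaf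
  Meaning leftˢ  s t = ∃[ u ] s ≡ node t u
  Meaning rightˢ s t = ∃[ u ] s ≡ node u t
  Meaning domˢ   s t = ⊤
  Meaning evalˢ  s t = s ⇓ t
  Meaning nextˢ  s t = t ≡ sucᵗ s
  Meaning valˢ   s t = s ≡ t
  Meaning inputˢ s t = s ≡ num n
  Meaning goalˢ  s t = node f (node (num n) leaf) ⇓ leaf
  Meaning _      s t = ⊥

  facts-hold : All (Holds Meaning num) (facts n)
  facts-hold = (refl , refl) ∷ _ ∷ refl ∷ refl ∷ steps n
    where
    steps : ∀ k → All (Holds Meaning num) (numeral-steps k)
    steps zero    = []
    steps (suc k) = refl ∷ _ ∷ steps k

  open TreeValue

  clauses-hold : All (SatisfiesClause Meaning) (clauses f)
  clauses-hold =
      (λ { θ (next ∷ val ∷ []) → trans next (cong (node leaf) val) })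
    ∷ (λ { θ (input ∷ val ∷ d ∷ []) →
           subst₂ (λ p t → node p (node t leaf) ⇓ leaf)
                  (trans (value-ground θ f) (fold-id f)) (trans (sym val) input) d })
    ∷ (λ { θ [] → ⇓zero })
    ∷ (λ { θ [] → ⇓succ })
    ∷ (λ { θ [] → ⇓proj-zero })
    ∷ (λ { θ (d ∷ []) → ⇓proj-suc d })
    ∷ (λ { θ (d ∷ e ∷ []) → ⇓comp d e })
    ∷ (λ { θ [] → ⇓list-[] })
    ∷ (λ { θ (d ∷ e ∷ []) → ⇓list-∷ d e })
    ∷ (λ { θ (d ∷ []) → ⇓prec-zero d })
    ∷ (λ { θ (d ∷ e ∷ []) → ⇓prec-suc d e })
    ∷ (λ { θ (d ∷ []) → ⇓min d })
    ∷ (λ { θ (d ∷ []) → ⇓search-stop d })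
    ∷ (λ { θ (d ∷ e ∷ []) → ⇓search-next d e })
    ∷ []

  rules-hold : All (SatisfiesGuarded Meaning) (guardedRules f)
  rules-hold =
      (λ σ _ _ → (λ _ → node (σ zero) (σ (suc zero))) , (_ , refl) ∷ (_ , refl) ∷ _ ∷ [])
    ∷ Allₚ.map⁺ (All.map (λ {c} → clause⇒rule Meaning leaf node proj₁ node-unique c) clauses-hold)
    where
    node-unique : ∀ {a b c} → Meaning leftˢ a b → Meaning rightˢ a c → a ≡ node b c
    node-unique (_ , refl) (_ , refl) = refl

-- Translation into quad-systems with a single context

module Translation (name : Symbol → URI) where

  context : URI
  context = 0

  factQuad : Atom ℕ → Quad Constant
  factQuad (s , P , o) = context , blank s , uri (name P) , blank o

  quads : ℕ → QuadGraph
  quads n = map factQuad (facts n)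

  patternQuad : ∀ {V} → Atom V → Quad (RuleTerm V)
  patternQuad (s , P , o) = context , inj₁ s , inj₂ (inj₁ (name P)) , inj₁ o

  premiseQuad : Atom (Fin m) → Quad (RuleTerm (Fin m ⊎ Fin 0))
  premiseQuad (s , P , o) = patternQuad (inj₁ s , P , inj₁ o)

  guard : Fin m → Atom (Fin m)
  guard i = i , domˢ , i

  -- All universal variables are taken as `x`, which the head may mention. The guard of the first
  -- variable is the head of the nonempty list.
  bridge : GuardedRule → BridgeRule
  bridge r = rule {suc #∀} {0} {#∃}
    (map⁺ premiseQuad (guard zero ∷ (tabulate (guard ∘ suc) ++ body))) (map⁺ patternQuad head)
    where open GuardedRule r

  -- The query does not name the input, so its code is the same for all `n`.
  goalQuery : CCQ 0
  goalQuery = ccq {#y = 2} ((context , inj₁ (inj₂ zero) , inj₂ (uri (name goalˢ)) , inj₁ (inj₂ (suc zero))) ∷ [])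

  .contexts-wellFormed : ∀ rs n → All (λ r → ContextsIn (contexts (quads n)) (BridgeRule.body r)
                                          × ContextsIn (contexts (quads n)) (BridgeRule.head r)) (map bridge rs)
  contexts-wellFormed rs n = Allₚ.map⁺ (All.universal wf rs)
    where
    wf : ∀ r → ContextsIn (contexts (quads n)) (BridgeRule.body (bridge r))
             × ContextsIn (contexts (quads n)) (BridgeRule.head (bridge r))
    wf r = here refl ∷ Allₚ.map⁺ (All.universal (λ _ → here refl) _)
         , single (GuardedRule.head r)
      where
      single : ∀ {V} (as : List⁺ (Atom V)) → ContextsIn (contexts (quads n)) (map⁺ patternQuad as)
      single (a ∷ as) = here refl ∷ Allₚ.map⁺ (All.universal (λ _ → here refl) as)

  system : List GuardedRule → ℕ → QuadSystem
  system rs n = quadSystem (quads n) (map bridge rs) (contexts-wellFormed rs n)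

  goalInstance : List GuardedRule → ℕ → Instance
  goalInstance rs n = inst (system rs n) goalQuery [] (here refl ∷ [])

  relations : ∀ {Ω} → Interpretation Ω → Relations Ω
  relations I P s o = Ext s ⟦ uri (name P) ⟧ o
    where open Interpretation I

  module _ {Ω : Set} (I : DistributedInterpretation Ω) {C : List URI} (here∈C : context ∈ C) where

    private
      R : Relations Ω
      R = relations (I context)
      open Interpretation (I context)

    member : ∀ {w} → R domˢ w w → ⋃Δ I C w
    member d = context , here∈C , proj₁ (Ext⊆Δ d)

    -- An assignment must take values in the union of the domains. The guards ensure this, because
    -- extensions lie within the domain.
    bridge⇒guarded : ∀ r → SatisfiesRule I C (bridge r) → SatisfiesGuarded R r
    bridge⇒guarded r sat σ ds hs = conclude (sat σ′ (ds zero ∷ premises))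
      where
      open GuardedRule r
      σ′ : Assignment I C (Fin (suc #∀) ⊎ Fin 0)
      σ′ (inj₁ i) = σ i , member (ds i)
      premises : All _ _
      premises = Allₚ.map⁺ (Allₚ.map⁺ (Allₚ.++⁺ (Allₚ.tabulate⁺ (ds ∘ suc)) hs))
      conclude : ∃[ τ ] SatisfiesAll I {C = C} [ σ′ ∘ inj₁ , τ ]′ _ → ∃[ τ ] All⁺ (Holds R [ σ , τ ]′) head
      conclude (τ , h ∷ hs) = proj₁ ∘ τ , atom (List⁺.head head) h ∷ All.map (λ {a} → atom a) (Allₚ.map⁻ (Allₚ.map⁻ hs))
        where
        atom : ∀ a → Holds R (proj₁ ∘ [ σ′ ∘ inj₁ , τ ]′) a → Holds R [ σ , proj₁ ∘ τ ]′ a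
        atom (s , P , o) = subst₂ (R P) ([,]-∘ proj₁ s) ([,]-∘ proj₁ o)

-- Entailment is equivalent to a run returning zero

module Correctness (L : LocalSemantics) (name : Symbol → URI) (n : ℕ) where

  open LocalSemantics L
  open Translation name

  entailed-if : ∀ rs →
    (∀ {Ω} (R : Relations Ω) → All (SatisfiesGuarded R) rs →
     (b : ℕ → Ω) → All (Holds R b) (facts n) → R goalˢ (b n) (b n)) →
    CCQEntailment L (goalInstance rs n)
  entailed-if rs goal I model =
    (λ _ → ⟦ blank n ⟧ , context , here refl , ⟦⟧∈Δ (blank n)) , goal-holds ∷ []
    where
    open IsModel model
    open Interpretation (I context)

    goal-holds : relations (I context) goalˢ ⟦ blank n ⟧ ⟦ blank n ⟧
    goal-holds = goal (relations (I context))
      (All.tabulate (λ {r} r∈ → bridge⇒guarded I (here refl) r (satisfies (∈-map⁺ bridge r∈))))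
      (λ k → ⟦ blank k ⟧)
      (All.tabulate (λ a∈ → graphs (here refl) _ (∈-map⁺ factQuad a∈)))

  -- Injectivity on URIs lets a predicate be read back as a symbol; URIs and blank nodes may share
  -- trees. The value at literals is an arbitrary default.
  denote : Constant → Tree
  denote (uri u)     = num u
  denote (blank k)   = num k
  denote (literal _) = leaf

  standard : Relations Tree → Interpretation Tree
  standard Meaning = record
    { Δ     = λ _ → ⊤
    ; ⟦_⟧   = denote
    ; ⟦⟧∈Δ  = λ _ → tt
    ; Ext   = λ s p o → ∃[ P ] p ≡ num (name P) × Meaning P s o
    ; Ext⊆Δ = λ _ → tt , tt , tt
    }

  module Extension (Meaning : Relations Tree)
                   (name-injective : Injective _≡_ _≡_ name) (name-unreserved : ∀ P → ¬ Reserved (name P))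
                   {Ω : Set} (I : Interpretation Ω) (ext : ConservativeExtension Reserved (standard Meaning) I)
    where

    open ConservativeExtension ext

    R : Relations Ω
    R = relations I

    C : List URI
    C = contexts (quads n)

    Meaning⇒R : ∀ P {s o} → Meaning P s o → R P (embed s) (embed o)
    Meaning⇒R P h = Equivalence.from (embed-Ext (name P) (name-unreserved P) _ _)
                                     (_ , _ , refl , refl , P , refl , h)

    -- Conservativity applies because the names are unreserved, and their injectivity identifies the
    -- symbol.
    R⇒Meaning : ∀ P {a b} → R P a b → ∃₂ λ s o → a ≡ embed s × b ≡ embed o × Meaning P s o
    R⇒Meaning P h
      with s , o , eqs , eqo , Q , eq , m ← Equivalence.to (embed-Ext (name P) (name-unreserved P) _ _) h
      with refl ← name-injective {P} {Q} (num-injective eq)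
      = s , o , eqs , eqo , m

    -- The extension may contain elements that are not trees. The guards pull every universal
    -- variable back along `embed`; the rule is applied to trees and its witnesses are embedded.
    guarded⇒bridge : ∀ r → SatisfiesGuarded Meaning r → SatisfiesRule (λ _ → I) C (bridge r)
    guarded⇒bridge r sat σ (h ∷ hs) = extend (sat s (λ i → premise (guard i) (guards i)) (All.map (λ {a} → premise a) (proj₂ split)))
      where
      open GuardedRule r

      split : All (Holds R (proj₁ ∘ σ ∘ inj₁)) (tabulate (guard ∘ suc)) × All (Holds R (proj₁ ∘ σ ∘ inj₁)) body
      split = Allₚ.++⁻ (tabulate (guard ∘ suc)) (Allₚ.map⁻ (Allₚ.map⁻ hs))

      guards : ∀ i → R domˢ (proj₁ (σ (inj₁ i))) (proj₁ (σ (inj₁ i)))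
      guards zero    = h
      guards (suc i) = Allₚ.tabulate⁻ (proj₁ split) i

      s : Fin (suc #∀) → Tree
      s i = proj₁ (R⇒Meaning domˢ (guards i))

      σ≡s : ∀ i → proj₁ (σ (inj₁ i)) ≡ embed (s i)
      σ≡s i = proj₁ (proj₂ (proj₂ (R⇒Meaning domˢ (guards i))))

      premise : ∀ a → Holds R (proj₁ ∘ σ ∘ inj₁) a → Holds Meaning s a
      premise (i , P , j) h with t , u , eqt , equ , m ← R⇒Meaning P h =
        subst₂ (Meaning P) (embed-injective (trans (sym eqt) (σ≡s i)))
                           (embed-injective (trans (sym equ) (σ≡s j))) m

      extend : ∃[ τ ] All⁺ (Holds Meaning [ s , τ ]′) head →
               ∃[ τ ] SatisfiesAll (λ _ → I) {C = C} [ σ ∘ inj₁ , τ ]′ _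
      extend (τ , h ∷ hs) = τ′ , atom (List⁺.head head) h ∷ Allₚ.map⁺ (Allₚ.map⁺ (All.map (λ {a} → atom a) hs))
        where
        τ′ : Assignment (λ _ → I) C (Fin #∃)
        τ′ j = embed (τ j) , context , here refl , embed-Δ tt

        term : ∀ v → embed ([ s , τ ]′ v) ≡ proj₁ ([ σ ∘ inj₁ , τ′ ]′ v)
        term (inj₁ i) = sym (σ≡s i)
        term (inj₂ j) = refl

        atom : ∀ a → Holds Meaning [ s , τ ]′ a → Holds R (proj₁ ∘ [ σ ∘ inj₁ , τ′ ]′) a
        atom (v , P , w) m = subst₂ (R P) (term v) (term w) (Meaning⇒R P m)

    isModel : ∀ rs → Admissible I → All (SatisfiesGuarded Meaning) rs → All (Holds Meaning num) (facts n) →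
              IsModel (λ _ → I) L (system rs n)
    isModel rs adm rules-hold facts-hold = record
      { admissible = λ _ → adm
      ; graphs     = λ _ t t∈ → fact (∈-map⁻ factQuad t∈)
      ; rigid      = λ _ _ _ → refl
      ; satisfies  = λ r∈ → bridged (∈-map⁻ bridge r∈)
      }
      where
      fact : ∀ {c t} → ∃[ a ] a ∈ facts n × (c , t) ≡ factQuad a → I ⊨ mapTriple inj₂ t
      fact ((j , P , k) , a∈ , refl) =
        subst₂ (R P) (sym (embed-⟦⟧ (blank j) _)) (sym (embed-⟦⟧ (blank k) _))
               (Meaning⇒R P (All.lookup facts-hold a∈))

      bridged : ∀ {b} → ∃[ r ] r ∈ rs × b ≡ bridge r → SatisfiesRule (λ _ → I) C b
      bridged (r , r∈ , refl) = guarded⇒bridge r (All.lookup rules-hold r∈)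

    query⇒goal : SatisfiesQuery (λ _ → I) C goalQuery [] → ∃₂ λ s t → Meaning goalˢ s t
    query⇒goal (_ , h ∷ []) with s , t , _ , _ , m ← R⇒Meaning goalˢ h = s , t , m

  entailed-only-if : Injective _≡_ _≡_ name → (∀ P → ¬ Reserved (name P)) →
    ∀ rs Meaning → All (SatisfiesGuarded Meaning) rs → All (Holds Meaning num) (facts n) →
    CCQEntailment L (goalInstance rs n) → ∃₂ λ s t → Meaning goalˢ s t
  entailed-only-if inj unres rs Meaning rules-hold facts-hold entailed
    with Ω , I , adm , ext ← conservative (standard Meaning) =
    query⇒goal (entailed (λ _ → I) (isModel rs adm rules-hold facts-hold))
    where open Extension Meaning inj unres I ext

  halts⇒entailed : ∀ f → node f (node (num n) leaf) ⇓ leaf → CCQEntailment L (goalInstance (guardedRules f) n)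
  halts⇒entailed f run = entailed-if (guardedRules f) λ R rules-hold b facts-hold →
    Canonical.goal R f n rules-hold b facts-hold run

  entailed⇒halts : Injective _≡_ _≡_ name → (∀ P → ¬ Reserved (name P)) →
    ∀ f → CCQEntailment L (goalInstance (guardedRules f) n) → node f (node (num n) leaf) ⇓ leaf
  entailed⇒halts inj unres f entailed = proj₂ (proj₂
    (entailed-only-if inj unres (guardedRules f) Meaning rules-hold facts-hold entailed))
    where open Standard f n

-- Computability of the code of an instance

Computable : (Vec ℕ n → ℕ) → Set
Computable {n} h = ∃[ f ] ∀ (xs : Vec ℕ n) → f [ xs ]↓ h xs

projᶜ : (i : Fin n) → Computable (λ xs → lookup xs i)
projᶜ i = proj i , λ _ → ↓proj

zeroᶜ : Computable {n} (λ _ → 0)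
zeroᶜ = comp zeroᶠ [] , λ _ → ↓comp [] ↓zero

sucᶜ : {g : Vec ℕ n → ℕ} → Computable g → Computable (λ xs → suc (g xs))
sucᶜ (g , g↓) = comp sucᶠ (g ∷ []) , λ xs → ↓comp (g↓ xs ∷ []) ↓suc

constᶜ : (k : ℕ) → Computable {n} (λ _ → k)
constᶜ zero    = zeroᶜ
constᶜ (suc k) = sucᶜ (constᶜ k)

comp₂ᶜ : {h : Vec ℕ 2 → ℕ} {g g′ : Vec ℕ n → ℕ} →
         Computable h → Computable g → Computable g′ → Computable (λ xs → h (g xs ∷ g′ xs ∷ []))
comp₂ᶜ (h , h↓) (g , g↓) (g′ , g′↓) =
  comp h (g ∷ g′ ∷ []) , λ xs → ↓comp (g↓ xs ∷ g′↓ xs ∷ []) (h↓ _)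

precᶜ : {h : Vec ℕ (suc n) → ℕ} {b : Vec ℕ n → ℕ} {s : Vec ℕ (suc (suc n)) → ℕ} →
        Computable b → Computable s →
        (∀ xs → h (0 ∷ xs) ≡ b xs) → (∀ k xs → h (suc k ∷ xs) ≡ s (k ∷ h (k ∷ xs) ∷ xs)) →
        Computable h
precᶜ {h = h} (b , b↓) (s , s↓) h-zero h-suc = prec b s , λ { (k ∷ xs) → prec↓ k xs }
  where
  prec↓ : ∀ k xs → prec b s [ k ∷ xs ]↓ h (k ∷ xs)
  prec↓ zero    xs rewrite h-zero xs  = ↓prec-zero (b↓ xs)
  prec↓ (suc k) xs rewrite h-suc k xs = ↓prec-suc (prec↓ k xs) (s↓ _)

addᶜ : Computable {2} (λ xs → lookup xs zero + lookup xs (suc zero))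
addᶜ = precᶜ (projᶜ zero) (sucᶜ (projᶜ (suc zero))) (λ { (y ∷ []) → refl }) (λ { k (y ∷ []) → refl })

doubleᶜ : {g : Vec ℕ n → ℕ} → Computable g → Computable (λ xs → 2 * g xs)
-- The inner sum with zero matches `2 * x`, which unfolds to `x + (x + 0)`.
doubleᶜ g = comp₂ᶜ addᶜ g (comp₂ᶜ addᶜ g zeroᶜ)

pair₂ᶜ : Computable {2} (λ xs → pair (lookup xs zero) (lookup xs (suc zero)))
pair₂ᶜ = precᶜ (sucᶜ (doubleᶜ (projᶜ zero))) (doubleᶜ (projᶜ (suc zero)))
               (λ { (y ∷ []) → refl }) (λ { k (y ∷ []) → refl })

pairᶜ : {g g′ : Vec ℕ n → ℕ} → Computable g → Computable g′ → Computable (λ xs → pair (g xs) (g′ xs))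
pairᶜ = comp₂ᶜ pair₂ᶜ

module CodeOfInstance (name : Symbol → URI) where

  open Translation name

  factCode : ℕ → Symbol → ℕ → ℕ
  factCode s P o = code (quadᶜ constantᶜ) (factQuad (s , P , o))

  factCodeᶜ : {g g′ : Vec ℕ n → ℕ} (P : Symbol) → Computable g → Computable g′ →
              Computable (λ xs → factCode (g xs) P (g′ xs))
  factCodeᶜ P g g′ = pairᶜ (constᶜ context) (pairᶜ (blankᶜ g) (pairᶜ (pairᶜ (constᶜ 0) (constᶜ (name P))) (blankᶜ g′)))
    where
    blankᶜ : {g : Vec ℕ _ → ℕ} → Computable g → Computable (λ xs → pair 1 (pair 0 (g xs)))
    blankᶜ g = pairᶜ (constᶜ 1) (pairᶜ (constᶜ 0) g)

  -- Codes are astronomically large, and opacity prevents their evaluation during type checking.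
  opaque
    factsCode : List (Atom ℕ) → ℕ
    factsCode as = code (Listᶜ (quadᶜ constantᶜ)) (map factQuad as)

    queryCode : CCQ 0 → ℕ
    queryCode q = code (Σᶜ {B = λ n → CCQ n × Vec Constant n} ℕᶜ (ccqᶜ ×ᶜ Vecᶜ constantᶜ)) (0 , q , [])

    rulesCode : List BridgeRule → ℕ
    rulesCode = code (Listᶜ bridgeRuleᶜ)

    systemCode : ℕ → ℕ → ℕ → ℕ
    systemCode q r k = pair (pair q r) k

    ∷Codeᶜ : {g g′ : Vec ℕ n → ℕ} {as : Vec ℕ n → List (Atom ℕ)} (P : Symbol) →
             Computable g → Computable g′ → Computable (λ xs → factsCode (as xs)) →
             Computable (λ xs → factsCode ((g xs , P , g′ xs) ∷ as xs))
    ∷Codeᶜ P g g′ as = pairᶜ (factCodeᶜ P g g′) as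

    ∷∷Codeᶜ : {g g′ h h′ : Vec ℕ n → ℕ} (P Q : Symbol) (i : Fin n) →
              Computable g → Computable g′ → Computable h → Computable h′ →
              Computable (λ xs → pair (factCode (g xs) P (g′ xs)) (pair (factCode (h xs) Q (h′ xs)) (lookup xs i)))
    ∷∷Codeᶜ P Q i g g′ h h′ = pairᶜ (factCodeᶜ P g g′) (pairᶜ (factCodeᶜ Q h h′) (projᶜ i))

    stepsCodeᶜ : Computable {1} (λ xs → factsCode (numeral-steps (lookup xs zero)))
    stepsCodeᶜ = precᶜ zeroᶜ
      (∷∷Codeᶜ nextˢ domˢ (suc zero) (projᶜ zero) (sucᶜ (projᶜ zero)) (sucᶜ (projᶜ zero)) (sucᶜ (projᶜ zero)))
      (λ { [] → refl }) (λ { k [] → refl })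

    systemCodeᶜ : {q r : Vec ℕ n → ℕ} (k : ℕ) → Computable q → Computable r →
                  Computable (λ xs → systemCode (q xs) (r xs) k)
    systemCodeᶜ k q r = pairᶜ (pairᶜ q r) (constᶜ k)

    code-instance : ∀ as rs q .wf .wf′ →
      code instanceᶜ (inst (quadSystem (map factQuad as) rs wf) q [] wf′) ≡
      systemCode (factsCode as) (rulesCode rs) (queryCode q)
    code-instance as rs q wf wf′ = refl

  quadsCodeᶜ : Computable {1} (λ xs → factsCode (facts (lookup xs zero)))
  quadsCodeᶜ =
    ∷Codeᶜ leafˢ zeroᶜ zeroᶜ (∷Codeᶜ domˢ zeroᶜ zeroᶜ (∷Codeᶜ valˢ zeroᶜ zeroᶜ
      (∷Codeᶜ inputˢ (projᶜ zero) (projᶜ zero) stepsCodeᶜ)))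

  -- The code `r` of the rules is an independent argument, so a program can compute with it without
  -- access to the rules themselves.
  instanceCode : ℕ → ℕ → ℕ
  instanceCode n r = systemCode (factsCode (facts n)) r (queryCode goalQuery)

  instanceCodeᶜ : Computable {1} (λ xs → instanceCode (lookup xs zero) (lookup xs zero))
  instanceCodeᶜ = systemCodeᶜ (queryCode goalQuery) quadsCodeᶜ (projᶜ zero)

  code-goalInstance : ∀ rs n → code instanceᶜ (goalInstance rs n) ≡ instanceCode n (rulesCode (map bridge rs))
  code-goalInstance rs n = code-instance (facts n) (map bridge rs) goalQuery (contexts-wellFormed rs n) (here refl ∷ [])

-- Unreserved names for the symbols

module Names (L : LocalSemantics) where

  open LocalSemantics L

  -- Each name is sought above the previous one; the sequence is strictly increasing, hence
  -- injective.
  name : Symbol → URI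
  name zero    = proj₁ (unreserved 0)
  name (suc P) = proj₁ (unreserved (suc (name P)))

  name-unreserved : ∀ P → ¬ Reserved (name P)
  name-unreserved zero    = proj₂ (proj₂ (unreserved 0))
  name-unreserved (suc P) = proj₂ (proj₂ (unreserved (suc (name P))))

  name-increasing : ∀ {P Q} → P <′ Q → name P < name Q
  name-increasing {P} <′-base          = proj₁ (proj₂ (unreserved (suc (name P))))
  name-increasing (≤′-step {n = Q} lt) = <-trans (name-increasing lt) (proj₁ (proj₂ (unreserved (suc (name Q)))))

  name-injective : Injective _≡_ _≡_ name
  name-injective {P} {Q} eq with <-cmp P Q
  ... | tri< P<Q _ _ = contradiction (name-increasing (<⇒<′ P<Q)) (<-irrefl eq)
  ... | tri≈ _ P≡Q _ = P≡Q
  ... | tri> _ _ Q<P = contradiction (name-increasing (<⇒<′ Q<P)) (<-irrefl (sym eq))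

-- Diagonalization

module Diagonal (L : LocalSemantics) (d : Rec 1) where

  open Names L
  open CodeOfInstance name
  open Translation name using (bridge; goalInstance)

  -- On input c, the program runs d on the code of the instance with input c whose rules have code c.
  program : Rec 1
  program = comp d (proj₁ instanceCodeᶜ ∷ [])

  module _ (self : Instance) (c : ℕ) (self-def : self ≡ goalInstance (guardedRules ⌜ program ⌝) c)
           (self-code : code instanceᶜ self ≡ instanceCode c c) where

    open Correctness L name c

    run : ∀ y → d [ code instanceᶜ self ∷ [] ]↓ y → node ⌜ program ⌝ (node (num c) leaf) ⇓ num y
    run y d↓ = ↓⇒⇓ (↓comp (proj₂ instanceCodeᶜ (c ∷ []) ∷ []) (subst (λ e → d [ e ∷ [] ]↓ y) self-code d↓))

    -- If `self` were entailed, the program would return both 1, from `d`, and 0, from the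
    -- entailment. So `self` is not entailed; then `d` answers 0, and this run makes `self`
    -- entailed. No case distinction on entailment is made.
    refute : ¬ Decides instanceᶜ d (CCQEntailment L)
    refute decides = ¬entailed (subst (CCQEntailment L) (sym self-def)
                                      (halts⇒entailed ⌜ program ⌝ (run 0 (proj₂ (decides self) ¬entailed))))
      where
      ¬entailed : ¬ CCQEntailment L self
      ¬entailed entailed
        with () ← ⇓-deterministic (run 1 (proj₁ (decides self) entailed))
                    (entailed⇒halts name-injective name-unreserved ⌜ program ⌝
                      (subst (CCQEntailment L) self-def entailed))

  undecided : ¬ Decides instanceᶜ d (CCQEntailment L)
  -- The number `c` serves both as input and as code of the rules. There is no circularity, since
  -- the program is fixed before `c`.
  undecided = refute (goalInstance rs c) c refl (code-goalInstance rs c)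
    where
    rs : List GuardedRule
    rs = guardedRules ⌜ program ⌝
    c : ℕ
    c = rulesCode (map bridge rs)

theorem1 : (L : LocalSemantics) → Undecidable instanceᶜ (CCQEntailment L)
theorem1 L (d , decides) = Diagonal.undecided L d decides
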